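{- Let $H$ be a fixed graph that is not a linear forest all of whose components are paths of length at most $5$. Then any streaming algorithm for \textsc{Connectivity} in the AL model that uses $p$ passes over the stream must use $\Omega(n/p)$ bits of memory on $n$-vertex graphs $G$, even when $G$ is $H$-free.
   Context: Graphs are finite, simple, undirected. A linear forest is a disjoint union of paths; the length of a path is its number of edges. $G$ is $H$-free if it has no induced subgraph isomorphic to $H$. \textsc{Connectivity}: decide whether $G$ is connected. In the Adjacency List (AL) streaming model the graph arrives as a sequence of vertices in arbitrary fixed order, each together with the full list of its incident edges (each edge appears twice). A $p$-pass algorithm reads the sequence $p$ times with unlimited computation; memory is measured in bits. "Must use $\Omega(f)$ bits" means there is a constant $c>0$ such that every $p$-pass algorithm solving the problem correctly on all inputs of the stated class uses at least $c\cdot f$ bits on some $n$-vertex input, for all sufficiently large $n$ and all $p$. -}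

module Defs where

open import Data.Bool using (Bool; true; false; _∨_)
open import Data.Nat using (_≤_)
open import Data.Nat using (ℕ; zero; suc; _∸_; _≤ᵇ_; _≡ᵇ_)
open import Data.Fin using (Fin; toℕ)
open import Data.Fin.Base using ()
open import Data.List.Base using (allFin)
open import Data.List using (List; []; _∷_; map; concatMap; foldl)
open import Data.Nat.ListAction using (sum)
open import Data.List.Membership.Propositional using (_∈_)
open import Data.List.Relation.Unary.Unique.Propositional using (Unique)
open import Data.List.Relation.Binary.Permutation.Propositional using (_↭_)
open import Data.List.Relation.Unary.All using (All)
open import Data.Vec using (Vec)
open import Data.Product using (Σ; ∃; _×_)
open import Data.Empty using (⊥)
open import Relation.Binary.PropositionalEquality using (_≡_)
open import Function.Bundles using (_⇔_; _⤖_; Bijection)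
open import Function.Definitions using (Injective)

record Graph (n : ℕ) : Set where
  field
    adj    : Fin n → Fin n → Bool
    sym    : ∀ i j → adj i j ≡ adj j i
    irrefl : ∀ i → adj i i ≡ false
open Graph public

InducedIn : ∀ {m n} → Graph m → Graph n → Set
InducedIn {m} {n} H G =
  Σ (Fin m → Fin n) λ f → Injective _≡_ _≡_ f × (∀ i j → adj H i j ≡ adj G (f i) (f j))

Free : ∀ {m n} → Graph m → Graph n → Set
Free H G = InducedIn H G → ⊥

data Reach {n} (G : Graph n) : Fin n → Fin n → Set where
  here : ∀ {u} → Reach G u u
  step : ∀ {u w v} → adj G u w ≡ true → Reach G w v → Reach G u v

Connected : ∀ {n} → Graph n → Set
Connected {n} G = ∀ (u v : Fin n) → Reach G u v

-- Linear forests: disjoint union of paths of lengths ls (length = #edges).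
-- The path of length l occupies l+1 consecutive vertex indices.

pfSize : List ℕ → ℕ
pfSize ls = sum (map suc ls)

pfAdj : List ℕ → ℕ → ℕ → Bool
pfAdj [] i j = false
pfAdj (l ∷ ls) i j with i ≤ᵇ l | j ≤ᵇ l
... | true  | true  = (suc i ≡ᵇ j) ∨ (suc j ≡ᵇ i)
... | false | false = pfAdj ls (i ∸ suc l) (j ∸ suc l)
... | _     | _     = false

SmallLinearForest : ∀ {m} → ℕ → Graph m → Set
SmallLinearForest {m} b H =
  Σ (List ℕ) λ ls → All (λ l → l ≤ b) ls ×
    Σ (Fin m ⤖ Fin (pfSize ls)) λ f →
      ∀ i j → adj H i j ≡ pfAdj ls (toℕ (Bijection.to f i)) (toℕ (Bijection.to f j))

-- Adjacency List streaming model.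
-- A stream token is either the announcement of a vertex v, or an edge
-- (v , u) from the adjacency list of the current vertex v.

data Item (n : ℕ) : Set where
  vtx : Fin n → Item n
  edg : Fin n → Fin n → Item n

IsNbrList : ∀ {n} → Graph n → Fin n → List (Fin n) → Set
IsNbrList {n} G v xs = Unique xs × (∀ (u : Fin n) → (u ∈ xs) ⇔ (adj G v u ≡ true))

IsALStream : ∀ {n} → Graph n → List (Item n) → Set
IsALStream {n} G str =
  Σ (List (Fin n)) λ order → (order ↭ allFin n) ×
    Σ (Fin n → List (Fin n)) λ nb → (∀ v → IsNbrList G v (nb v)) ×
      (str ≡ concatMap (λ v → vtx v ∷ map (edg v) (nb v)) order)

-- A deterministic p-pass streaming algorithm on n-vertex inputs using
-- s bits of memory (state = s bits; computation is unrestricted).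
-- The index of the current pass is supplied to the transition function.
record Alg (n p s : ℕ) : Set where
  field
    init : Vec Bool s
    next : Fin p → Vec Bool s → Item n → Vec Bool s
    out  : Vec Bool s → Bool

runAlg : ∀ {n p s} → Alg n p s → List (Item n) → Bool
runAlg {n} {p} {s} A str =
  Alg.out A (foldl (λ st i → foldl (Alg.next A i) st str) (Alg.init A) (allFin p))

SolvesConnHFree : ∀ {m n p s} → Graph m → Alg n p s → Set
SolvesConnHFree {m} {n} H A =
  ∀ (G : Graph n) → Free H G → ∀ str → IsALStream G str →
    (runAlg A str ≡ true ⇔ Connected G)

{-# OPTIONS --safe #-}
module Submission where

-- Gadget i consists of a path c(A,i), d(A,i), d(B,i), c(B,i) whose outer edges are present according to
-- Alice's and Bob's i-th bits, and the vertices c form a connected core. The graph is connected iff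
-- every gadget keeps an outer edge, so on complementary inputs it is connected while any two such
-- inputs can be crossed to a disconnected one: this fooling set forces one bit of communication per
-- gadget, hence 2ps to be at least the number of free gadgets.
-- If the core is a clique, a triangle-free induced subgraph contains at most two core vertices, and
-- if it moreover has no 4-cycle, then it is a linear forest with at most 6 vertices per path. If the
-- core is a star, the graph has neither triangles nor 4-cycles. So H is missing from every
-- graph of at least one of the two families.

open import Defs hiding (sym)
open import Data.Bool using (Bool; true; false; not; _∨_)
import Data.Bool.Properties as Bool
open import Data.Empty using (⊥; ⊥-elim)
open import Data.Fin using (Fin; toℕ; fromℕ<; cast; combine; remQuot)
open import Data.Fin.Properties
  using (any?; toℕ-injective; toℕ-cast; toℕ<n; toℕ-fromℕ<; pigeonhole; combine-injective; combine-remQuot; 2↔Bool)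
import Data.Fin.Properties as Fin
open import Data.List using (List; []; _∷_; _++_; map; foldl; filter; concat; concatMap; allFin; length; lookup)
open import Data.List.Properties using (length-++; length-tabulate; foldl-++; concatMap-++; map-cong-local)
open import Data.List.Membership.Propositional using (_∈_)
open import Data.List.Membership.Propositional.Properties using (∈-lookup; ∈-filter⁺; ∈-filter⁻; ∈-allFin)
import Data.List.Membership.DecPropositional as DecMembership
open import Data.List.Relation.Binary.Permutation.Propositional using (_↭_; refl; prep; ↭-trans)
open import Data.List.Relation.Binary.Permutation.Propositional.Properties using (shift)
open import Data.List.Relation.Unary.All as All using (All; []; _∷_)
import Data.List.Relation.Unary.All.Properties as All
open import Data.List.Relation.Unary.AllPairs using ([]; _∷_)
open import Data.List.Relation.Unary.Any using (here; there; index)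
open import Data.List.Relation.Unary.Any.Properties using (lookup-index)
open import Data.List.Relation.Unary.Unique.Propositional using (Unique)
import Data.List.Relation.Unary.Unique.Propositional.Properties as Unique
open import Data.Nat using (ℕ; zero; suc; _+_; _*_; _∸_; _^_; _%_; _≤_; _<_; _≤ᵇ_; _≡ᵇ_; _≤?_; z≤n; s≤s)
import Data.Nat as ℕ
open import Data.Nat.DivMod using ([m+kn]%n≡m%n; m<n⇒m%n≡m)
open import Data.Nat.Properties
open import Data.Nat.Solver using (module +-*-Solver)
open import Data.Product using (Σ; ∃; _×_; _,_; proj₁; proj₂)
open import Data.Product.Properties using (≡-dec)
open import Data.Sum as Sum using (_⊎_; inj₁; inj₂)
open import Data.Unit using (⊤; tt)
open import Data.Vec as Vec using (Vec; []; _∷_)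
open import Function using (_∘_)
open import Function.Bundles using (_⇔_; mk⇔; mk⤖; Equivalence; Inverse)
open import Relation.Binary.Definitions using (DecidableEquality)
open import Relation.Binary.PropositionalEquality
open import Relation.Nullary using (¬_; Dec; yes; no; does; ¬?)
open import Relation.Nullary.Decidable using (_×-dec_; _⊎-dec_; map′; dec-true; does-⇔; decidable-stable)

-- Linear forests from vertex positions

bound : ∀ {m} (φ : Fin m → ℕ) → Σ ℕ λ b → ∀ v → φ v < b
bound {zero}  φ = 0 , λ ()
bound {suc m} φ with bound (φ ∘ Fin.suc)
... | b , φ<b = suc (φ Fin.zero) + b , λ where
  Fin.zero    → m≤m+n _ b
  (Fin.suc v) → ≤-trans (φ<b v) (m≤n+m b _)

index-injective : ∀ {A : Set} {x y : A} {xs} (i : x ∈ xs) (j : y ∈ xs) → index i ≡ index j → x ≡ y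
index-injective {xs = xs} i j eq =
  trans (lookup-index i) (trans (cong (lookup xs) eq) (sym (lookup-index j)))

index-irrelevant : ∀ {A : Set} {x : A} {xs} → Unique xs → (i j : x ∈ xs) → index i ≡ index j
index-irrelevant _        (here _)     (here _)     = refl
index-irrelevant (a ∷ _)  (here refl)  (there j)    = ⊥-elim (All.lookup a j refl)
index-irrelevant (a ∷ _)  (there i)    (here refl)  = ⊥-elim (All.lookup a i refl)
index-irrelevant (_ ∷ us) (there i)    (there j)    = cong Fin.suc (index-irrelevant us i j)

index-∈-lookup : ∀ {A : Set} (xs : List A) k → index (∈-lookup {xs = xs} k) ≡ k
index-∈-lookup (x ∷ xs) Fin.zero    = refl
index-∈-lookup (x ∷ xs) (Fin.suc k) = cong Fin.suc (index-∈-lookup xs k)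

≤⇒≤ᵇ-true : ∀ {i j} → i ≤ j → (i ≤ᵇ j) ≡ true
≤⇒≤ᵇ-true {i} {j} i≤j with i ≤ᵇ j | ≤⇒≤ᵇ i≤j
... | true | _ = refl

<⇒≤ᵇ-false : ∀ i k → (suc (i + k) ≤ᵇ i) ≡ false
<⇒≤ᵇ-false zero    k = refl
<⇒≤ᵇ-false (suc i) zero    = <⇒≤ᵇ-false i zero
<⇒≤ᵇ-false (suc i) (suc k) = <⇒≤ᵇ-false i (suc k)

-- Mirrors the case distinction made by `pfAdj`: a position lies in the first path, or in the rest
-- once the vertices of the first path are subtracted.
data SplitIndex {A : Set} {x : A} (xs ys : List A) (i : x ∈ xs ++ ys) : Set where
  left  : (j : x ∈ xs) → toℕ (index i) ≡ toℕ (index j) → SplitIndex xs ys i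
  right : (j : x ∈ ys) → toℕ (index i) ≡ length xs + toℕ (index j) → SplitIndex xs ys i

splitIndex : ∀ {A : Set} {x : A} xs {ys} (i : x ∈ xs ++ ys) → SplitIndex xs ys i
splitIndex []       i           = right i refl
splitIndex (x ∷ xs) (here refl) = left (here refl) refl
splitIndex (x ∷ xs) (there i) with splitIndex xs i
... | left  j eq = left (there j) (cong suc eq)
... | right j eq = right j (cong suc eq)

module _ {m} (H : Graph m) where

  private
    V : Set
    V = Fin m

  NonAdj : V → V → Set
  NonAdj u v = adj H u v ≡ false

  NonAdj-sym : ∀ {u v} → NonAdj u v → NonAdj v u
  NonAdj-sym {u} {v} e = trans (Graph.sym H v u) e

  -- Nonadjacency to everything beyond the next vertex makes the path induced. Keeping the head
  -- apart makes the length of the tail the number of edges.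
  data IsPath : V → List V → Set where
    end  : ∀ {x} → IsPath x []
    link : ∀ {x y zs} → adj H x y ≡ true → All (NonAdj x) zs → IsPath y zs → IsPath x (y ∷ zs)

  flatten : List (V × List V) → List V
  flatten []             = []
  flatten ((x , xs) ∷ P) = (x ∷ xs) ++ flatten P

  lengths : List (V × List V) → List ℕ
  lengths = map (length ∘ proj₂)

  data IsLinearForest : List (V × List V) → Set where
    []  : IsLinearForest []
    _∷_ : ∀ {x xs P} → IsPath x xs × All (λ u → All (NonAdj u) (flatten P)) (x ∷ xs) × length xs ≤ 5 →
          IsLinearForest P → IsLinearForest ((x , xs) ∷ P)

  path-adj : ∀ {x xs u v} → IsPath x xs → (i : u ∈ x ∷ xs) (j : v ∈ x ∷ xs) →
    let i′ = toℕ (index i) ; j′ = toℕ (index j) in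
    adj H u v ≡ (suc i′ ≡ᵇ j′) ∨ (suc j′ ≡ᵇ i′)
  path-adj _            (here refl) (here refl) = irrefl H _
  path-adj (link e _ _) (here refl) (there (here refl)) = e
  path-adj (link _ n _) (here refl) (there (there j)) = All.lookup n j
  path-adj (link e _ _) (there (here refl)) (here refl) = trans (Graph.sym H _ _) e
  path-adj (link _ n _) (there (there i)) (here refl) = NonAdj-sym (All.lookup n i)
  path-adj (link _ _ p) (there i) (there j) = path-adj p i j

  -- Two positions in the first path compare by `path-adj`, positions in different paths are
  -- nonadjacent by the apartness condition, and two later positions recurse after the shift that
  -- `pfAdj` also performs.
  forest-adj : ∀ {P u v} → IsLinearForest P → (i : u ∈ flatten P) (j : v ∈ flatten P) →
    adj H u v ≡ pfAdj (lengths P) (toℕ (index i)) (toℕ (index j))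
  forest-adj {(x , xs) ∷ P} ((p , apart , _) ∷ F) i j
    with splitIndex (x ∷ xs) i | splitIndex (x ∷ xs) j
  ... | left i′ e | left j′ e′
    rewrite e | e′ | ≤⇒≤ᵇ-true (≤-pred (toℕ<n (index i′))) | ≤⇒≤ᵇ-true (≤-pred (toℕ<n (index j′)))
    = path-adj p i′ j′
  ... | left i′ e | right j′ e′
    rewrite e | e′ | ≤⇒≤ᵇ-true (≤-pred (toℕ<n (index i′))) | <⇒≤ᵇ-false (length xs) (toℕ (index j′))
    = All.lookup (All.lookup apart i′) j′
  ... | right i′ e | left j′ e′
    rewrite e | e′ | <⇒≤ᵇ-false (length xs) (toℕ (index i′)) | ≤⇒≤ᵇ-true (≤-pred (toℕ<n (index j′)))
    = NonAdj-sym (All.lookup (All.lookup apart j′) i′)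
  ... | right i′ e | right j′ e′
    rewrite e | e′ | <⇒≤ᵇ-false (length xs) (toℕ (index i′)) | <⇒≤ᵇ-false (length xs) (toℕ (index j′))
          | m+n∸m≡n (length xs) (toℕ (index i′)) | m+n∸m≡n (length xs) (toℕ (index j′))
    = forest-adj F i′ j′

  size-lengths : ∀ P → length (flatten P) ≡ pfSize (lengths P)
  size-lengths []             = refl
  size-lengths ((x , xs) ∷ P) = cong suc (trans (length-++ xs) (cong (length xs +_) (size-lengths P)))

  lengths≤5 : ∀ {P} → IsLinearForest P → All (_≤ 5) (lengths P)
  lengths≤5 []                  = []
  lengths≤5 ((_ , _ , l) ∷ F) = l ∷ lengths≤5 F

  forest⇒small : ∀ P → IsLinearForest P → Unique (flatten P) → (∀ v → v ∈ flatten P) →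
    SmallLinearForest 5 H
  forest⇒small P F uniq mem = lengths P , lengths≤5 F , mk⤖ (injective , surjective) , adjacency
    where
    to : V → Fin (pfSize (lengths P))
    to v = cast (size-lengths P) (index (mem v))
    toℕ-to : ∀ v → toℕ (to v) ≡ toℕ (index (mem v))
    toℕ-to v = toℕ-cast _ (index (mem v))
    injective : ∀ {u v} → to u ≡ to v → u ≡ v
    injective {u} {v} eq = index-injective (mem u) (mem v)
      (toℕ-injective (trans (sym (toℕ-to u)) (trans (cong toℕ eq) (toℕ-to v))))
    -- `mem` might point to another occurrence of the entry; distinctness of the entries forces its
    -- index back to `k′`.
    surjective : ∀ k → ∃ λ v → ∀ {w} → w ≡ v → to w ≡ k
    surjective k = lookup (flatten P) k′ , λ where
        refl → toℕ-injective (trans (toℕ-to _) (trans (cong toℕ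
          (trans (index-irrelevant uniq (mem _) (∈-lookup k′)) (index-∈-lookup (flatten P) k′)))
          (toℕ-cast _ k)))
      where k′ = cast (sym (size-lengths P)) k
    adjacency : ∀ i j → adj H i j ≡ pfAdj (lengths P) (toℕ (to i)) (toℕ (to j))
    adjacency i j rewrite toℕ-to i | toℕ-to j = forest-adj F (mem i) (mem j)

  -- φ lists the vertices and ψ is the position inside a segment of at most 6; the paths are
  -- grown leftwards at their heads, so that only the first path can still be extended.
  module Sweep
    (φ ψ : V → ℕ)
    (φ-injective : ∀ {u v} → φ u ≡ φ v → u ≡ v)
    (ψ≤5 : ∀ v → ψ v ≤ 5)
    (consecutive : ∀ u v → adj H u v ≡ true →
      (φ v ≡ suc (φ u) × ψ v ≡ suc (ψ u)) ⊎ (φ u ≡ suc (φ v) × ψ u ≡ suc (ψ v)))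
    where

    -- Prepending a vertex lowers `ψ` at the head by one, so the sum in the first conjunct is
    -- invariant under extension and keeps bounding the length. The second conjunct makes the head
    -- the only listed vertex that the next inserted vertex can be adjacent to.
    Headed : List (V × List V) → Set
    Headed []             = ⊤
    Headed ((x , xs) ∷ P) = ψ x + length xs ≤ 5 × All (λ v → φ x < φ v) (xs ++ flatten P)

    record Swept (t : ℕ) : Set where
      field
        paths  : List (V × List V)
        forest : IsLinearForest paths
        unique : Unique (flatten paths)
        above  : All (λ v → t ≤ φ v) (flatten paths)
        covers : ∀ v → t ≤ φ v → v ∈ flatten paths
        headed : Headed paths

    nonadjacent : ∀ {u v} → suc (φ u) < φ v → NonAdj u v
    nonadjacent {u} {v} lt with adj H u v in e
    ... | false = refl
    ... | true with consecutive u v e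
    ...   | inj₁ (eq , _) = ⊥-elim (<⇒≢ lt (sym eq))
    ...   | inj₂ (eq , _) = ⊥-elim (<-asym lt (subst (φ v <_) (sym (cong suc eq)) (m≤n⇒m≤1+n ≤-refl)))

    successor : ∀ {u v} → φ u < φ v → adj H u v ≡ true → φ v ≡ suc (φ u) × ψ v ≡ suc (ψ u)
    successor {u} {v} lt e with consecutive u v e
    ... | inj₁ r        = r
    ... | inj₂ (eq , _) = ⊥-elim (<-asym lt (subst (φ v <_) (sym eq) ≤-refl))

    -- Since `u` lies below everything listed, its only possible neighbour is the head of the first
    -- path; all other entries exceed `φ u` by at least two. So `u` either extends that path or
    -- starts a new one.
    insert : ∀ u → Swept (suc (φ u)) → Swept (φ u)
    insert u S = go paths forest unique above covers headed
      where
      open Swept S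
      fresh : ∀ {xs} → All (λ v → suc (φ u) ≤ φ v) xs → All (u ≢_) xs
      fresh = All.map (λ lt eq → <⇒≢ lt (cong φ eq))
      weaken : ∀ {xs} → All (λ v → suc (φ u) ≤ φ v) xs → All (λ v → φ u ≤ φ v) xs
      weaken = All.map <⇒≤
      covered : ∀ {xs} → (∀ v → suc (φ u) ≤ φ v → v ∈ xs) → ∀ v → φ u ≤ φ v → v ∈ u ∷ xs
      covered cov v le with φ v ℕ.≟ φ u
      ... | yes eq = here (φ-injective eq)
      ... | no neq = there (cov v (≤∧≢⇒< le (neq ∘ sym)))
      alone : ∀ P → IsLinearForest P → Unique (flatten P) → All (λ v → suc (φ u) ≤ φ v) (flatten P) →
        (∀ v → suc (φ u) ≤ φ v → v ∈ flatten P) → All (NonAdj u) (flatten P) → Swept (φ u)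
      alone P F uq ab cov na = record
        { paths = (u , []) ∷ P ; forest = (end , na ∷ [] , z≤n) ∷ F
        ; unique = fresh ab ∷ uq ; above = ≤-refl ∷ weaken ab ; covers = covered cov
        ; headed = subst (_≤ 5) (sym (+-identityʳ (ψ u))) (ψ≤5 u) , ab }
      go : ∀ P → IsLinearForest P → Unique (flatten P) → All (λ v → suc (φ u) ≤ φ v) (flatten P) →
        (∀ v → suc (φ u) ≤ φ v → v ∈ flatten P) → Headed P → Swept (φ u)
      go [] F uq ab cov hd = alone [] F uq ab cov []
      go ((x , xs) ∷ P) F@((p , apart , _) ∷ F′) uq ab@(lt ∷ _) cov (ψx≤ , hd) = case-adj
        where
        far : All (NonAdj u) (xs ++ flatten P)
        far = All.map (λ lt′ → nonadjacent (≤-<-trans lt lt′)) hd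
        case-adj : Swept (φ u)
        case-adj with adj H u x in e
        ... | false = alone ((x , xs) ∷ P) F uq ab cov (e ∷ far)
        ... | true  = record
          { paths = (u , x ∷ xs) ∷ P
          ; forest = (link e (All.++⁻ˡ xs far) p , All.++⁻ʳ xs far ∷ apart , ≤-trans (m≤n+m _ (ψ u)) ψu≤) ∷ F′
          ; unique = fresh ab ∷ uq ; above = ≤-refl ∷ weaken ab ; covers = covered cov
          ; headed = ψu≤ , ab }
          where
          -- The additional edge is paid for by the drop of `ψ` from `x` to `u`.
          ψu≤ : ψ u + suc (length xs) ≤ 5
          ψu≤ = subst (_≤ 5) (trans (cong (_+ length xs) (proj₂ (successor lt e))) (sym (+-suc (ψ u) _))) ψx≤

    vacant : ∀ {t} → (∀ v → φ v ≢ t) → Swept (suc t) → Swept t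
    vacant none S = record
      { paths = paths ; forest = forest ; unique = unique ; above = All.map <⇒≤ above
      ; covers = λ v le → covers v (≤∧≢⇒< le (none v ∘ sym)) ; headed = headed }
      where open Swept S

    -- The sum `k + t` stays an upper bound for `φ`, so the recursion bottoms out where no vertex is
    -- left and then inserts vertices for decreasing `t`, stepping over gaps in the values of `φ`.
    sweep : ∀ k t → (∀ v → φ v < k + t) → Swept t
    sweep zero t lt = record
      { paths = [] ; forest = [] ; unique = [] ; above = []
      ; covers = λ v le → ⊥-elim (<⇒≱ (lt v) le) ; headed = tt }
    sweep (suc k) t lt with sweep k (suc t) (λ v → subst (φ v <_) (sym (+-suc k t)) (lt v))
    ... | S with any? (λ v → φ v ℕ.≟ t)
    ...   | yes (u , refl) = insert u S
    ...   | no none        = vacant (λ v eq → none (v , eq)) S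

    small : SmallLinearForest 5 H
    small = forest⇒small paths forest unique (λ v → covers v z≤n)
      where open Swept (sweep (proj₁ (bound φ)) 0 (λ v → subst (φ v <_) (sym (+-identityʳ _)) (proj₂ (bound φ) v)))

-- The gadget graphs

-- (false , i) belongs to Alice's half of gadget i, (true , i) to Bob's half.
Port : Set
Port = Bool × ℕ

flip : Port → Port
flip (s , i) = not s , i

root : Port
root = false , 0

flip-involutive : ∀ p → flip (flip p) ≡ p
flip-involutive (s , i) = cong (_, i) (Bool.not-involutive s)

flip-≢ : ∀ p → p ≢ flip p
flip-≢ (false , i) ()
flip-≢ (true  , i) ()

_≟ₚ_ : DecidableEquality Port
_≟ₚ_ = ≡-dec Bool._≟_ ℕ._≟_

data Role : Set where
  core dangling : Port → Role

port : Role → Port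
port (core p)     = p
port (dangling p) = p

core-injective : ∀ {p q} → core p ≡ core q → p ≡ q
core-injective refl = refl

dangling-injective : ∀ {p q} → dangling p ≡ dangling q → p ≡ q
dangling-injective refl = refl

_≟ᵣ_ : DecidableEquality Role
core p     ≟ᵣ core q     = map′ (cong core) core-injective (p ≟ₚ q)
core p     ≟ᵣ dangling q = no λ ()
dangling p ≟ᵣ core q     = no λ ()
dangling p ≟ᵣ dangling q = map′ (cong dangling) dangling-injective (p ≟ₚ q)

open DecMembership _≟ᵣ_ using (_∈?_)

-- Gadgets are numbered in blocks of four, core vertices before dangling ones. Hence cutting the
-- numbering off at any `n` never leaves a dangling vertex without its core vertex.
role : ℕ → Role
role 0 = core (false , 0)
role 1 = core (true , 0)
role 2 = dangling (false , 0)
role 3 = dangling (true , 0)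
role (suc (suc (suc (suc v)))) with role v
... | core (s , i)     = core (s , suc i)
... | dangling (s , i) = dangling (s , suc i)

code : Role → ℕ
code (core (false , i))     = i * 4
code (core (true , i))      = 1 + i * 4
code (dangling (false , i)) = 2 + i * 4
code (dangling (true , i))  = 3 + i * 4

code-role : ∀ v → code (role v) ≡ v
code-role 0 = refl
code-role 1 = refl
code-role 2 = refl
code-role 3 = refl
code-role (suc (suc (suc (suc v)))) with role v | code-role v
... | core (false , i)     | refl = refl
... | core (true , i)      | refl = refl
... | dangling (false , i) | refl = refl
... | dangling (true , i)  | refl = refl

role-code : ∀ r → role (code r) ≡ r
role-code (core (false , zero))     = refl
role-code (core (true , zero))      = refl
role-code (dangling (false , zero)) = refl
role-code (dangling (true , zero))  = refl
role-code (core (false , suc i))     rewrite role-code (core (false , i))     = refl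
role-code (core (true , suc i))      rewrite role-code (core (true , i))      = refl
role-code (dangling (false , suc i)) rewrite role-code (dangling (false , i)) = refl
role-code (dangling (true , suc i))  rewrite role-code (dangling (true , i))  = refl

code-core<code-dangling : ∀ p → code (core p) < code (dangling p)
code-core<code-dangling (false , i) = m≤n+m (suc (i * 4)) 1
code-core<code-dangling (true , i)  = m≤n+m (2 + i * 4) 1

code≤ : ∀ r → code r ≤ 3 + proj₂ (port r) * 4
code≤ (core (false , i))     = m≤n+m _ 3
code≤ (core (true , i))      = m≤n+m _ 2
code≤ (dangling (false , i)) = m≤n+m _ 1
code≤ (dangling (true , i))  = ≤-refl

-- The field `rooted` joins every core vertex to one fixed vertex, so that both families share a
-- single connectivity argument.
record Core : Set₁ where
  field
    Adj       : Port → Port → Set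
    adj?      : ∀ p q → Dec (Adj p q)
    symmetric : ∀ {p q} → Adj p q → Adj q p
    loopless  : ∀ {p} → ¬ Adj p p
    rooted    : ∀ {p} → p ≢ root → Adj p root

clique : Core
clique = record
  { Adj = _≢_ ; adj? = λ p q → ¬? (p ≟ₚ q) ; symmetric = λ ne → ne ∘ sym
  ; loopless = λ ne → ne refl ; rooted = λ ne → ne }

star : Core
star = record
  { Adj       = λ p q → (p ≡ root × q ≢ root) ⊎ (p ≢ root × q ≡ root)
  ; adj?      = λ p q → ((p ≟ₚ root) ×-dec ¬? (q ≟ₚ root)) ⊎-dec (¬? (p ≟ₚ root) ×-dec (q ≟ₚ root))
  ; symmetric = λ where (inj₁ (e , n)) → inj₂ (n , e)
                        (inj₂ (n , e)) → inj₁ (e , n)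
  ; loopless  = λ where (inj₁ (e , n)) → n e
                        (inj₂ (n , e)) → n e
  ; rooted    = λ n → inj₂ (n , refl) }

-- b says whether the dangling vertex at the port of the first endpoint is attached to the core.
data Edge (K : Core) (b : Bool) : Role → Role → Set where
  core-core         : ∀ {p q} → Core.Adj K p q → Edge K b (core p) (core q)
  core-dangling     : ∀ {p} → b ≡ true → Edge K b (core p) (dangling p)
  dangling-core     : ∀ {p} → b ≡ true → Edge K b (dangling p) (core p)
  dangling-dangling : ∀ {p q} → q ≡ flip p → Edge K b (dangling p) (dangling q)

edge? : ∀ K b r r′ → Dec (Edge K b r r′)
edge? K b (core p) (core q) = map′ core-core (λ { (core-core e) → e }) (Core.adj? K p q)
edge? K b (core p) (dangling q) =
  map′ (λ { (refl , e) → core-dangling e }) (λ { (core-dangling e) → refl , e }) ((p ≟ₚ q) ×-dec (b Bool.≟ true))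
edge? K b (dangling p) (core q) =
  map′ (λ { (refl , e) → dangling-core e }) (λ { (dangling-core e) → refl , e }) ((p ≟ₚ q) ×-dec (b Bool.≟ true))
edge? K b (dangling p) (dangling q) =
  map′ dangling-dangling (λ { (dangling-dangling e) → e }) (q ≟ₚ flip p)

module _ (K : Core) (z : Port → Bool) where

  Joined : Role → Role → Set
  Joined r = Edge K (z (port r)) r

  joined? : ∀ r r′ → Dec (Joined r r′)
  joined? r = edge? K (z (port r)) r

  Joined-sym : ∀ {r r′} → Joined r r′ → Joined r′ r
  Joined-sym (core-core e)     = core-core (Core.symmetric K e)
  Joined-sym (core-dangling e) = dangling-core e
  Joined-sym (dangling-core e) = core-dangling e
  Joined-sym (dangling-dangling {p} refl) = dangling-dangling (sym (flip-involutive p))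

  Joined-irrefl : ∀ {r} → ¬ Joined r r
  Joined-irrefl (core-core e)             = Core.loopless K e
  Joined-irrefl (dangling-dangling {p} e) = flip-≢ p e

roleOf : ∀ {n} → Fin n → Role
roleOf v = role (toℕ v)

roleOf-injective : ∀ {n} {u v : Fin n} → roleOf u ≡ roleOf v → u ≡ v
roleOf-injective {u = u} {v} e =
  toℕ-injective (trans (sym (code-role (toℕ u))) (trans (cong code e) (code-role (toℕ v))))

vertex : ∀ {n} r → code r < n → Σ (Fin n) λ v → roleOf v ≡ r
vertex r lt = fromℕ< lt , trans (cong role (toℕ-fromℕ< lt)) (role-code r)

gadgetGraph : Core → (Port → Bool) → ∀ n → Graph n
gadgetGraph K z n = record
  { adj    = λ u v → does (joined? K z (roleOf u) (roleOf v))
  ; sym    = λ u v → does-⇔ (mk⇔ (Joined-sym K z) (Joined-sym K z))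
                              (joined? K z (roleOf u) (roleOf v)) (joined? K z (roleOf v) (roleOf u))
  ; irrefl = λ v → irreflexive (roleOf v) }
  where
  irreflexive : ∀ r → does (joined? K z r r) ≡ false
  irreflexive r with joined? K z r r
  ... | yes e = ⊥-elim (Joined-irrefl K z e)
  ... | no _  = refl

module _ {K : Core} {z : Port → Bool} {n : ℕ} where

  private
    G = gadgetGraph K z n

  adj⇒Joined : ∀ u v → adj G u v ≡ true → Joined K z (roleOf u) (roleOf v)
  adj⇒Joined u v e with joined? K z (roleOf u) (roleOf v)
  ... | yes j = j

  Joined⇒adj : ∀ u v → Joined K z (roleOf u) (roleOf v) → adj G u v ≡ true
  Joined⇒adj u v = dec-true (joined? K z (roleOf u) (roleOf v))

  Reach-trans : ∀ {u v w} → Reach G u v → Reach G v w → Reach G u w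
  Reach-trans here       r = r
  Reach-trans (step e q) r = step e (Reach-trans q r)

  Reach-sym : ∀ {u v} → Reach G u v → Reach G v u
  Reach-sym here = here
  Reach-sym (step {u} {w} e r) = Reach-trans (Reach-sym r) (step (trans (Graph.sym G w u) e) here)

  module _ {T} (T≤ : suc T * 4 ≤ n) where

    private
      inside : ∀ r → proj₂ (port r) ≤ T → Σ (Fin n) λ v → roleOf v ≡ r
      inside r i≤T = vertex r (<-≤-trans (s≤s (≤-trans (code≤ r) (+-monoʳ-≤ 3 (*-monoˡ-≤ 4 i≤T)))) T≤)

      o : Fin n
      o = proj₁ (inside (core root) z≤n)

      o-role : roleOf o ≡ core root
      o-role = proj₂ (inside (core root) z≤n)

    -- Core vertices reach the root directly, attached dangling vertices through their core vertex,
    -- and the others through their partner. The bound in the second alternative ensures that the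
    -- partner survives truncation to `n` vertices.
    connected : (∀ p → z p ≡ true ⊎ (z (flip p) ≡ true × proj₂ p ≤ T)) → Connected G
    connected attached u v = Reach-trans (toRoot u) (Reach-sym (toRoot v))
      where
      edge : ∀ u v {r r′} → roleOf u ≡ r → roleOf v ≡ r′ → Joined K z r r′ → adj G u v ≡ true
      edge u v refl refl = Joined⇒adj u v
      below : ∀ (v : Fin n) {r} r′ → roleOf v ≡ r → code r′ < code r → code r′ < n
      below v r′ refl lt = <-trans lt (subst (_< n) (sym (code-role (toℕ v))) (toℕ<n v))
      fromCore : ∀ v {p} → roleOf v ≡ core p → Reach G v o
      fromCore v {p} e with p ≟ₚ root
      ... | yes refl = subst (λ w → Reach G w o) (roleOf-injective (trans o-role (sym e))) here
      ... | no ne    = step (edge v o e o-role (core-core (Core.rooted K ne))) here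
      fromAttached : ∀ v {p} → roleOf v ≡ dangling p → z p ≡ true → Reach G v o
      fromAttached v {p} e zp with vertex (core p) (below v (core p) e (code-core<code-dangling p))
      ... | w , e′ = step (edge v w e e′ (dangling-core zp)) (fromCore w e′)
      toRoot : ∀ v → Reach G v o
      toRoot v with roleOf v in e
      ... | core p = fromCore v e
      ... | dangling p with attached p
      ...   | inj₁ zp = fromAttached v e zp
      ...   | inj₂ (zp , i≤T) with inside (dangling (flip p)) i≤T
      ...     | w , e′ = step (edge v w e e′ (dangling-dangling refl)) (fromAttached w e′ zp)

    -- With both outer edges missing, the two dangling vertices of the gadget form a component that
    -- avoids the root.
    disconnected : ∀ p → proj₂ p ≤ T → z p ≡ false → z (flip p) ≡ false → ¬ Connected G
    disconnected p i≤T zp zp′ conn with inside (dangling p) i≤T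
    ... | v , e = stuck v (inj₁ e) (conn v o)
      where
      Isolated : Role → Set
      Isolated r = r ≡ dangling p ⊎ r ≡ dangling (flip p)
      closed : ∀ {r r′} → Isolated r → Joined K z r r′ → Isolated r′
      closed (inj₁ refl) (dangling-core zt) with trans (sym zp) zt
      ... | ()
      closed (inj₁ refl) (dangling-dangling eq) = inj₂ (cong dangling eq)
      closed (inj₂ refl) (dangling-core zt) with trans (sym zp′) zt
      ... | ()
      closed (inj₂ refl) (dangling-dangling eq) = inj₁ (cong dangling (trans eq (flip-involutive p)))
      rootIsolated : ¬ Isolated (core root)
      rootIsolated (inj₁ ())
      rootIsolated (inj₂ ())
      stuck : ∀ w → Isolated (roleOf w) → Reach G w o → ⊥
      stuck _ i here               = rootIsolated (subst Isolated o-role i)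
      stuck u i (step {w = w} a r) = stuck w (closed i (adj⇒Joined u w a)) r

-- Common induced subgraphs of the two families

-- Half-attaching gadget 0, whose core vertex is the centre of the star, rules out the 4-cycle
-- through its two core vertices.
Anchored : (Port → Bool) → Set
Anchored z = z root ≡ true × z (flip root) ≡ false

TriangleFree : {A : Set} → (A → A → Set) → Set
TriangleFree _~_ = ∀ {r₁ r₂ r₃} → r₁ ~ r₂ → r₂ ~ r₃ → r₁ ~ r₃ → ⊥

SquareFree : {A : Set} → (A → A → Set) → Set
SquareFree _~_ = ∀ {r₁ r₂ r₃ r₄} → r₁ ~ r₂ → r₂ ~ r₃ → r₃ ~ r₄ → r₄ ~ r₁ → r₁ ≢ r₃ → r₂ ≢ r₄ → ⊥

Edges : ∀ {m} → Graph m → Fin m → Fin m → Set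
Edges H u v = adj H u v ≡ true

-- Each core edge has exactly one end at the root, so the core has no odd cycle. A dangling vertex
-- has at most two neighbours, its core vertex and its partner, and these are nonadjacent.
star-triangleFree : ∀ {z} → TriangleFree (Joined star z)
star-triangleFree (core-core (inj₁ (p , q))) (core-core (inj₁ (q′ , r))) _ = q q′
star-triangleFree (core-core (inj₁ (p , q))) (core-core (inj₂ (q′ , r))) (core-core (inj₁ (p′ , r′))) = r′ r
star-triangleFree (core-core (inj₁ (p , q))) (core-core (inj₂ (q′ , r))) (core-core (inj₂ (p′ , r′))) = p′ p
star-triangleFree (core-core (inj₂ (p , q))) (core-core (inj₁ (q′ , r))) (core-core (inj₁ (p′ , r′))) = p p′
star-triangleFree (core-core (inj₂ (p , q))) (core-core (inj₁ (q′ , r))) (core-core (inj₂ (p′ , r′))) = r r′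
star-triangleFree (core-core (inj₂ (p , q))) (core-core (inj₂ (q′ , r))) _ = q′ q
star-triangleFree (core-core e) (core-dangling _) (core-dangling _) = Core.loopless star e
star-triangleFree (core-dangling _) (dangling-core _) (core-core e) = Core.loopless star e
star-triangleFree (core-dangling _) (dangling-dangling e) (core-dangling _) = flip-≢ _ e
star-triangleFree (dangling-core _) (core-core e) (dangling-core _) = Core.loopless star e
star-triangleFree (dangling-core _) (core-dangling _) (dangling-dangling e) = flip-≢ _ e
star-triangleFree (dangling-dangling e) (dangling-core _) (dangling-core _) = flip-≢ _ e
star-triangleFree (dangling-dangling refl) (dangling-dangling refl) (dangling-dangling e) = flip-≢ _ (sym e)

module _ {z} (anchored : Anchored z) where

  -- Core vertices of the same gadget are adjacent in the star only if one is the root; this is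
  -- gadget 0, which is half attached.
  star-bridge : ∀ {p} → Core.Adj star p (flip p) → z p ≡ true → z (flip p) ≡ true → ⊥
  star-bridge (inj₁ (refl , _)) _ e with trans (sym (proj₂ anchored)) e
  ... | ()
  star-bridge {p} (inj₂ (_ , e)) zp _
    with trans (sym (proj₂ anchored)) (trans (cong (z ∘ flip) (sym e)) (trans (cong z (flip-involutive p)) zp))
  ... | ()

  -- Within the core, two opposite corners would both be the root. A 4-cycle through a dangling
  -- vertex would consist of all four vertices of one gadget, which `star-bridge` excludes.
  star-squareFree : SquareFree (Joined star z)
  star-squareFree (core-core (inj₁ (p , q))) (core-core (inj₁ (q′ , r))) _ _ _ _ = q q′
  star-squareFree (core-core (inj₂ (p , q))) (core-core (inj₂ (q′ , r))) _ _ _ _ = q′ q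
  star-squareFree (core-core (inj₁ (p , q))) (core-core (inj₂ (q′ , r))) _ _ n _ = n (cong core (trans p (sym r)))
  star-squareFree (core-core (inj₂ (p , q))) (core-core (inj₁ (q′ , r))) (core-core (inj₁ (r′ , t))) _ _ n = r r′
  star-squareFree (core-core (inj₂ (p , q))) (core-core (inj₁ (q′ , r))) (core-core (inj₂ (r′ , t))) _ _ n = n (cong core (trans q (sym t)))
  star-squareFree (core-core _) (core-core _) (core-dangling _) (dangling-core _) n _ = n refl
  star-squareFree (core-core _) (core-dangling _) (dangling-core _) _ _ n = n refl
  star-squareFree (core-core e) (core-dangling zq) (dangling-dangling refl) (dangling-core zp) _ _ =
    star-bridge (Core.symmetric star e) zq zp
  star-squareFree (core-dangling _) (dangling-core _) _ _ n _ = n refl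
  star-squareFree (core-dangling zp) (dangling-dangling refl) (dangling-core zq) (core-core e) _ _ =
    star-bridge (Core.symmetric star e) zp zq
  star-squareFree (core-dangling _) (dangling-dangling _) (dangling-dangling _) (dangling-core _) _ n = n refl
  star-squareFree (dangling-core _) (core-dangling _) _ _ n _ = n refl
  star-squareFree (dangling-core _) (core-core _) (core-core _) (core-dangling _) _ n = n refl
  star-squareFree (dangling-core zp) (core-core e) (core-dangling zq) (dangling-dangling refl) _ _ =
    star-bridge (Core.symmetric star e) zq zp
  star-squareFree (dangling-dangling refl) (dangling-core zq) (core-core e) (core-dangling zp) _ _ =
    star-bridge (Core.symmetric star e) zp zq
  star-squareFree (dangling-dangling _) (dangling-core _) (core-dangling _) (dangling-dangling _) _ n = n refl
  star-squareFree (dangling-dangling refl) (dangling-dangling refl) _ _ n _ =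
    n (cong dangling (sym (flip-involutive _)))

-- Consecutive entries may be related but need not be: the edges present among them then cut the
-- list into paths.
data Chain {A : Set} (_~_ : A → A → Set) : List A → Set where
  []  : Chain _~_ []
  [-] : ∀ {x} → Chain _~_ (x ∷ [])
  _∷_ : ∀ {x y zs} → All (λ z → ¬ (x ~ z)) zs → Chain _~_ (y ∷ zs) → Chain _~_ (x ∷ y ∷ zs)

Consecutive : ℕ → ℕ → Set
Consecutive i j = j ≡ suc i ⊎ i ≡ suc j

chain-consecutive : ∀ {A : Set} {_~_ : A → A → Set} → (∀ {x y} → x ~ y → y ~ x) → (∀ {x} → ¬ (x ~ x)) →
  ∀ {xs x y} → Chain _~_ xs → (i : x ∈ xs) (j : y ∈ xs) → x ~ y → Consecutive (toℕ (index i)) (toℕ (index j))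
chain-consecutive sy ir c       (here refl)         (here refl)         e = ⊥-elim (ir e)
chain-consecutive sy ir (n ∷ c) (here refl)         (there (here _))    e = inj₁ refl
chain-consecutive sy ir (n ∷ c) (here refl)         (there (there j))   e = ⊥-elim (All.lookup n j e)
chain-consecutive sy ir (n ∷ c) (there (here _))    (here refl)         e = inj₂ refl
chain-consecutive sy ir (n ∷ c) (there (there i))   (here refl)         e = ⊥-elim (All.lookup n i (sy e))
chain-consecutive sy ir (n ∷ c) (there i)           (there j)           e =
  Sum.map (cong suc) (cong suc) (chain-consecutive sy ir c i j e)

-- Uniqueness of base 6 digits: reduction modulo 6 recovers the low digit. It separates the blocks
-- of `Window`.
mixed-radix-injective : ∀ {a a′} b b′ → a ≤ 5 → a′ ≤ 5 → a + b * 6 ≡ a′ + b′ * 6 → a ≡ a′ × b ≡ b′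
mixed-radix-injective {a} {a′} b b′ a≤5 a′≤5 eq =
  a≡a′ , *-cancelʳ-≡ b b′ 6 (+-cancelˡ-≡ a _ _ (trans eq (cong (_+ b′ * 6) (sym a≡a′))))
  where
  a≡a′ : a ≡ a′
  a≡a′ = begin
    a                   ≡⟨ m<n⇒m%n≡m (s≤s a≤5) ⟨
    a % 6               ≡⟨ [m+kn]%n≡m%n a b 6 ⟨
    (a + b * 6) % 6     ≡⟨ cong (_% 6) eq ⟩
    (a′ + b′ * 6) % 6   ≡⟨ [m+kn]%n≡m%n a′ b′ 6 ⟩
    a′ % 6              ≡⟨ m<n⇒m%n≡m (s≤s a′≤5) ⟩
    a′                  ∎
    where open ≡-Reasoning

module InClique {m} (H : Graph m) {z : Port → Bool} (g : Fin m → Role)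
  (g-injective : ∀ {u v} → g u ≡ g v → u ≡ v)
  (sound    : ∀ u v → Edges H u v → Joined clique z (g u) (g v))
  (complete : ∀ u v → Joined clique z (g u) (g v) → Edges H u v)
  where

  -- Adjacency of `H` carried over to roles. It fails at roles not taken by any vertex of `H`, so a
  -- window can list roles whether or not they occur.
  _~_ : Role → Role → Set
  r ~ r′ = Σ (Fin m) λ u → Σ (Fin m) λ v → g u ≡ r × g v ≡ r′ × Edges H u v

  ~-sym : ∀ {r r′} → r ~ r′ → r′ ~ r
  ~-sym (u , v , e , e′ , a) = v , u , e′ , e , trans (Graph.sym H v u) a

  ~⇒Joined : ∀ {r r′} → r ~ r′ → Joined clique z r r′
  ~⇒Joined (u , v , refl , refl , a) = sound u v a

  ~-irrefl : ∀ {r} → ¬ (r ~ r)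
  ~-irrefl = Joined-irrefl clique z ∘ ~⇒Joined

  -- W contains all core vertices of H; every other component is a dangling pair or a single vertex.
  module Window (W : List Role) (short : length W ≤ 6) (chain : Chain _~_ W)
    (gadgets : All (λ r → dangling (port r) ∈ W × dangling (flip (port r)) ∈ W) W)
    (cores : ∀ v p → g v ≡ core p → core p ∈ W)
    where

    -- Edges into the core stay in the window because it contains all cores of `H`; edges to
    -- dangling vertices stay because the window contains both dangling vertices of each gadget it
    -- meets.
    closed : ∀ u v → Edges H u v → g u ∈ W → g v ∈ W
    closed u v a i with g u | g v in e | sound u v a
    ... | _ | _ | core-core _            = cores v _ e
    ... | _ | _ | dangling-core _        = cores v _ e
    ... | _ | _ | core-dangling _        = proj₁ (All.lookup gadgets i)
    ... | _ | _ | dangling-dangling refl = proj₂ (All.lookup gadgets i)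

    offset : Bool → ℕ
    offset false = 0
    offset true  = 1

    -- Block 0 is the window and block `suc i` is the dangling pair of gadget `i`. A core outside
    -- the window does not occur in `H`, so its values are mere placeholders.
    block inner : ∀ r → Dec (r ∈ W) → ℕ
    block _                  (yes _) = 0
    block (core _)           (no _)  = 0
    block (dangling (_ , i)) (no _)  = suc i
    inner _                  (yes i) = toℕ (index i)
    inner (core _)           (no _)  = 0
    inner (dangling (s , _)) (no _)  = offset s

    inner≤5 : ∀ r d → inner r d ≤ 5
    inner≤5 r                      (yes i) = ≤-pred (<-≤-trans (toℕ<n (index i)) short)
    inner≤5 (core _)               (no _)  = z≤n
    inner≤5 (dangling (false , _)) (no _)  = z≤n
    inner≤5 (dangling (true , _))  (no _)  = s≤s z≤n

    position-injective : ∀ u v (d : Dec (g u ∈ W)) (d′ : Dec (g v ∈ W)) →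
      inner _ d ≡ inner _ d′ → block _ d ≡ block _ d′ → g u ≡ g v
    position-injective u v (yes i) (yes j) e _ = index-injective i j (toℕ-injective e)
    position-injective u v (yes i) (no n) _ e with g v in eq
    ... | core p = ⊥-elim (n (cores v p eq))
    ... | dangling p with e
    ...   | ()
    position-injective u v (no n) (yes j) _ e with g u in eq
    ... | core p = ⊥-elim (n (cores u p eq))
    ... | dangling p with e
    ...   | ()
    position-injective u v (no n) (no n′) e e′ with g u in eq | g v in eq′
    ... | core p     | _          = ⊥-elim (n (cores u p eq))
    ... | dangling _ | core p     = ⊥-elim (n′ (cores v p eq′))
    ... | dangling (false , i) | dangling (false , j) = cong (λ k → dangling (false , k)) (suc-injective e′)
    ... | dangling (true , i)  | dangling (true , j)  = cong (λ k → dangling (true , k)) (suc-injective e′)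

    -- Inside the window this is the chain property. No edge leaves the window, and outside it the
    -- only edges join the two dangling vertices of a gadget, at offsets 0 and 1.
    position-consecutive : ∀ u v → Edges H u v → (d : Dec (g u ∈ W)) (d′ : Dec (g v ∈ W)) →
      block _ d ≡ block _ d′ × Consecutive (inner _ d) (inner _ d′)
    position-consecutive u v a (yes i) (yes j) =
      refl , chain-consecutive ~-sym ~-irrefl chain i j (u , v , refl , refl , a)
    position-consecutive u v a (yes i) (no n) = ⊥-elim (n (closed u v a i))
    position-consecutive u v a (no n) (yes j) = ⊥-elim (n (closed v u (trans (Graph.sym H v u) a) j))
    position-consecutive u v a (no n) (no n′) with g u in eq | g v in eq′ | sound u v a
    ... | _ | _ | core-core _     = ⊥-elim (n (cores u _ eq))
    ... | _ | _ | core-dangling _ = ⊥-elim (n (cores u _ eq))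
    ... | _ | _ | dangling-core _ = ⊥-elim (n′ (cores v _ eq′))
    ... | _ | _ | dangling-dangling {false , i} refl = refl , inj₁ refl
    ... | _ | _ | dangling-dangling {true , i}  refl = refl , inj₂ refl

    ψ φ : Fin m → ℕ
    ψ v = inner (g v) (g v ∈? W)
    φ v = ψ v + block (g v) (g v ∈? W) * 6

    small : SmallLinearForest 5 H
    small = Sweep.small H φ ψ
      (λ {u} {v} e → let d = g u ∈? W ; d′ = g v ∈? W
                         ψ≡ , b≡ = mixed-radix-injective (block _ d) (block _ d′) (inner≤5 _ d) (inner≤5 _ d′) e in
        g-injective (position-injective u v d d′ ψ≡ b≡))
      (λ v → inner≤5 _ (g v ∈? W))
      λ u v a → let b≡ , c = position-consecutive u v a (g u ∈? W) (g v ∈? W) in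
        Sum.map (λ e → cong₂ (λ x y → x + y * 6) e (sym b≡) , e)
                (λ e → cong₂ (λ x y → x + y * 6) e b≡ , e) c

  ¬dangling~core : ∀ {p q} → p ≢ q → ¬ (dangling p ~ core q)
  ¬dangling~core ne a with ~⇒Joined a
  ... | dangling-core _ = ne refl

  ¬core~dangling : ∀ {p q} → p ≢ q → ¬ (core p ~ dangling q)
  ¬core~dangling ne = ¬dangling~core (ne ∘ sym) ∘ ~-sym

  ¬dangling~dangling : ∀ {p q} → q ≢ flip p → ¬ (dangling p ~ dangling q)
  ¬dangling~dangling ne a with ~⇒Joined a
  ... | dangling-dangling e = ne e

  CoresIn : Port → Port → Set
  CoresIn p q = ∀ v r → g v ≡ core r → r ≡ p ⊎ r ≡ q

  flip-swap : ∀ {p q} → flip p ≡ q → p ≡ flip q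
  flip-swap {p} e = trans (sym (flip-involutive p)) (cong flip e)

  flip-∈ : ∀ p {W} → dangling p ∈ W → dangling (flip (flip p)) ∈ W
  flip-∈ p {W} = subst (λ q → dangling q ∈ W) (sym (flip-involutive p))

  -- The window runs from the far end of one gadget through the core edge to the far end of the
  -- other. These six vertices are the source of the bound 5 on path lengths.
  differentGadgets : ∀ p q → p ≢ q → q ≢ flip p → CoresIn p q → SmallLinearForest 5 H
  differentGadgets p q p≢q q≢p′ cs = Window.small
    (dangling (flip p) ∷ dangling p ∷ core p ∷ core q ∷ dangling q ∷ dangling (flip q) ∷ []) ≤-refl
    ( (¬dangling~core (flip-≢ p ∘ sym) ∷ ¬dangling~core (q≢p′ ∘ sym) ∷
       ¬dangling~dangling (λ e → p≢q (trans (sym (flip-involutive p)) (sym e))) ∷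
       ¬dangling~dangling (λ e → q≢p′ (flip-swap (trans e (flip-involutive p)))) ∷ [])
    ∷ (¬dangling~core p≢q ∷ ¬dangling~dangling q≢p′ ∷
       ¬dangling~dangling (λ e → p≢q (trans (sym (flip-involutive p)) (sym (flip-swap e)))) ∷ [])
    ∷ (¬core~dangling p≢q ∷ ¬core~dangling (q≢p′ ∘ flip-swap ∘ sym) ∷ [])
    ∷ (¬core~dangling (flip-≢ q) ∷ [])
    ∷ [] ∷ [-])
    ((p′∈ , flip-∈ p p∈) ∷ (p∈ , p′∈) ∷ (p∈ , p′∈) ∷ (q∈ , q′∈) ∷ (q∈ , q′∈) ∷ (q′∈ , flip-∈ q q∈) ∷ [])
    λ v r e → Sum.[ (λ { refl → there (there (here refl)) })
                  , (λ { refl → there (there (there (here refl))) }) ] (cs v r e)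
    where
    p′∈ = here refl
    p∈  = there (here refl)
    q∈  = there (there (there (there (here refl))))
    q′∈ = there (there (there (there (there (here refl)))))

  -- The four roles of one gadget lie on a cycle; the missing outer edge at `p` opens it into a
  -- chain.
  sameGadget : ∀ p → ¬ (core p ~ dangling p) → CoresIn p (flip p) → SmallLinearForest 5 H
  sameGadget p cut cs = Window.small
    (dangling p ∷ dangling (flip p) ∷ core (flip p) ∷ core p ∷ []) (s≤s (s≤s (s≤s (s≤s z≤n))))
    ((¬dangling~core (flip-≢ p) ∷ cut ∘ ~-sym ∷ []) ∷ (¬dangling~core (flip-≢ p ∘ sym) ∷ []) ∷ [] ∷ [-])
    ((p∈ , p′∈) ∷ (p′∈ , flip-∈ p p∈) ∷ (p′∈ , flip-∈ p p∈) ∷ (p∈ , p′∈) ∷ [])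
    λ v r e → Sum.[ (λ { refl → there (there (there (here refl))) })
                  , (λ { refl → there (there (here refl)) }) ] (cs v r e)
    where
    p∈  = here refl
    p′∈ = there (here refl)

  core? : ∀ r → Dec (Σ Port λ p → r ≡ core p)
  core? (core p)     = yes (p , refl)
  core? (dangling p) = no λ ()

  _~?_ : ∀ r r′ → Dec (r ~ r′)
  r ~? r′ = any? λ u → any? λ v → (g u ≟ᵣ r) ×-dec (g v ≟ᵣ r′) ×-dec (adj H u v Bool.≟ true)

  module _ (triangleFree : TriangleFree (Edges H)) (squareFree : SquareFree (Edges H)) where

    coreEdge : ∀ {u v p q} → g u ≡ core p → g v ≡ core q → u ≢ v → Edges H u v
    coreEdge {u} {v} e e′ ne = complete u v (subst₂ (Joined clique z) (sym e) (sym e′)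
      (core-core λ { refl → ne (g-injective (trans e (sym e′))) }))

    -- Three core vertices in a clique would give a triangle in `H`.
    fewCores : Σ Port λ p → Σ Port λ q → p ≢ q × CoresIn p q
    fewCores with any? (core? ∘ g)
    ... | no none = (false , 0) , (true , 0) , (λ ()) , λ v r e → ⊥-elim (none (v , r , e))
    ... | yes (u , p , eu) with any? (λ v → core? (g v) ×-dec ¬? (v Fin.≟ u))
    -- With a single core vertex, the second port is a filler; taking it from the next gadget makes
    -- it differ from `p`.
    ...   | no none = p , (false , suc (proj₂ p)) , (λ e → 1+n≢n (sym (cong proj₂ e))) , only
      where
      only : CoresIn p (false , suc (proj₂ p))
      only v r e with v Fin.≟ u
      ... | yes refl = inj₁ (core-injective (trans (sym e) eu))
      ... | no ne    = ⊥-elim (none (v , (r , e) , ne))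
    ...   | yes (v , (q , ev) , v≢u) = p , q , (λ { refl → v≢u (g-injective (trans ev (sym eu))) }) , both
      where
      both : CoresIn p q
      both w r e with w Fin.≟ u | w Fin.≟ v
      ... | yes refl | _        = inj₁ (core-injective (trans (sym e) eu))
      ... | no _     | yes refl = inj₂ (core-injective (trans (sym e) ev))
      ... | no w≢u   | no w≢v   = ⊥-elim (triangleFree
        (coreEdge eu ev (v≢u ∘ sym)) (coreEdge ev e (w≢v ∘ sym)) (coreEdge eu e (w≢u ∘ sym)))

    -- If both outer edges of the gadget were present in `H`, they would close a 4-cycle with the
    -- dangling edge and the core edge.
    bridgeCut : ∀ {p} → core p ~ dangling p → ¬ (core (flip p) ~ dangling (flip p))
    bridgeCut {p} (u , v , eu , ev , a) (u′ , v′ , eu′ , ev′ , a′) = squareFree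
      a
      (complete v v′ (subst₂ (Joined clique z) (sym ev) (sym ev′) (dangling-dangling refl)))
      (trans (Graph.sym H v′ u′) a′)
      (coreEdge eu′ eu λ { refl → flip-≢ p (core-injective (trans (sym eu) eu′)) })
      (λ { refl → core≢dangling (trans (sym eu) ev′) })
      (λ { refl → core≢dangling (trans (sym eu′) ev) })
      where
      core≢dangling : ∀ {p q} → core p ≢ dangling q
      core≢dangling ()

    small : SmallLinearForest 5 H
    small with fewCores
    ... | p , q , p≢q , cs with q ≟ₚ flip p
    ...   | no q≢p′ = differentGadgets p q p≢q q≢p′ cs
    ...   | yes refl with core p ~? dangling p
    ...     | no cut     = sameGadget p cut cs
    ...     | yes bridge = sameGadget (flip p) (bridgeCut bridge)
      λ v r e → Sum.[ (λ r≡p → inj₂ (trans r≡p (sym (flip-involutive p)))) , inj₁ ] (cs v r e)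

-- The star copy contributes only the absence of triangles and 4-cycles; the forest structure is
-- then read off the clique copy.
smallFromBoth : ∀ {m} (H : Graph m) {n n′ z z′} → Anchored z′ →
  InducedIn H (gadgetGraph clique z n) → InducedIn H (gadgetGraph star z′ n′) → SmallLinearForest 5 H
smallFromBoth H {n} {n′} {z} {z′} anchored (f , f-injective , f-adj) (f′ , f′-injective , f′-adj) =
  InClique.small H {z} (roleOf ∘ f) (f-injective ∘ roleOf-injective)
    (λ u v a → adj⇒Joined {clique} {z} (f u) (f v) (trans (sym (f-adj u v)) a))
    (λ u v j → trans (f-adj u v) (Joined⇒adj {clique} {z} (f u) (f v) j))
    (λ a b c → star-triangleFree {z′} (inStar a) (inStar b) (inStar c))
    (λ a b c d u≢w v≢x → star-squareFree {z′} anchored (inStar a) (inStar b) (inStar c) (inStar d)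
      (u≢w ∘ f′-injective ∘ roleOf-injective) (v≢x ∘ f′-injective ∘ roleOf-injective))
  where
  inStar : ∀ {u v} → Edges H u v → Joined star z′ (roleOf (f′ u)) (roleOf (f′ v))
  inStar {u} {v} a = adj⇒Joined {star} {z′} (f′ u) (f′ v) (trans (sym (f′-adj u v)) a)

-- Communication

encode : ∀ {A : Set} {N} (e : A → Fin N) k → Vec A k → Fin (N ^ k)
encode e zero    []      = Fin.zero
encode e (suc k) (a ∷ v) = combine (e a) (encode e k v)

encode-injective : ∀ {A : Set} {N} {e : A → Fin N} → (∀ {a b} → e a ≡ e b → a ≡ b) →
  ∀ k {u v} → encode e k u ≡ encode e k v → u ≡ v
encode-injective inj zero    {[]}    {[]}    _ = refl
encode-injective inj (suc k) {a ∷ u} {b ∷ v} eq with combine-injective _ _ _ _ eq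
... | eq₁ , eq₂ = cong₂ _∷_ (inj eq₁) (encode-injective inj k eq₂)

bit : Bool → Fin 2
bit = Inverse.from 2↔Bool

bit-injective : ∀ {a b} → bit a ≡ bit b → a ≡ b
bit-injective {false} {false} _ = refl
bit-injective {true}  {true}  _ = refl

bits : ∀ T → Fin (2 ^ T) → Vec Bool T
bits zero    _ = []
bits (suc T) k = let b , k′ = remQuot (2 ^ T) k in Inverse.to 2↔Bool b ∷ bits T k′

encode-bits : ∀ T k → encode bit T (bits T k) ≡ k
encode-bits zero    Fin.zero = refl
encode-bits (suc T) k = let b , k′ = remQuot (2 ^ T) k in
  trans (cong₂ combine (Inverse.strictlyInverseʳ 2↔Bool b) (encode-bits T k′)) (combine-remQuot {2} (2 ^ T) k)

module _ {S X Y I : Set} (alice : X → I → S → S) (bob : Y → I → S → S) where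

  run : X → Y → S → List I → S
  run x y = foldl (λ st i → bob y i (alice x i st))

  -- The messages of the two-party protocol: the memory contents handed over after each half of a
  -- pass.
  transcript : X → Y → S → (L : List I) → Vec (S × S) (length L)
  transcript x y st []       = []
  transcript x y st (i ∷ is) =
    let a = alice x i st ; b = bob y i a in (a , b) ∷ transcript x y b is

  -- Inputs with equal transcripts form a combinatorial rectangle.
  run-mixed : ∀ {x y x′ y′} st L → transcript x y st L ≡ transcript x′ y′ st L →
    run x y′ st L ≡ run x y st L
  run-mixed st [] eq = refl
  run-mixed {x} {y} {x′} {y′} st (i ∷ is) eq
    with alice x i st | alice x′ i st | eq
  ... | a | a′ | eq′ with bob y i a in e | bob y′ i a′ in e′ | eq′
  ...   | b | b′ | eq″ with cong (proj₁ ∘ Vec.head) eq″ | cong (proj₂ ∘ Vec.head) eq″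
  -- Alice's message is the same from `x` as from `x′`, so Bob, holding `y′`, answers it with the
  -- common message `b`.
  ...     | refl | refl rewrite e′ = run-mixed b is (cong Vec.tail eq″)

-- Streams that list Alice's vertices before Bob's

filter-sides : ∀ {A : Set} (side : A → Bool) xs →
  filter (λ x → side x Bool.≟ false) xs ++ filter (λ x → side x Bool.≟ true) xs ↭ xs
filter-sides side [] = refl
filter-sides side (x ∷ xs) with side x
... | false = prep x (filter-sides side xs)
... | true  = ↭-trans (shift x (filter (λ x → side x Bool.≟ false) xs) _) (prep x (filter-sides side xs))

sideOf : ∀ {n} → Fin n → Bool
sideOf v = proj₁ (port (roleOf v))

module _ (K : Core) (n : ℕ) where

  -- Taking a single bit instead of the whole wiring shows that a neighbour list depends only on the
  -- bit at the vertex's own port. So each player can write their half of the stream alone.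
  neighbours : Bool → Fin n → List (Fin n)
  neighbours b v = filter (λ u → edge? K b (roleOf v) (roleOf u)) (allFin n)

  segment : (Port → Bool) → List (Fin n) → List (Item n)
  segment z = concatMap (λ v → vtx v ∷ map (edg v) (neighbours (z (port (roleOf v))) v))

  half : Bool → List (Fin n)
  half s = filter (λ v → sideOf v Bool.≟ s) (allFin n)

  segment-local : ∀ {z z′} s → (∀ i → z (s , i) ≡ z′ (s , i)) → segment z (half s) ≡ segment z′ (half s)
  segment-local {z} {z′} s same = cong concat (map-cong-local
    (All.map (λ {v} e → cong (λ b → vtx v ∷ map (edg v) (neighbours b v)) (agree (port (roleOf v)) e))
             (All.all-filter (λ v → sideOf v Bool.≟ s) (allFin n))))
    where
    agree : ∀ p → proj₁ p ≡ s → z p ≡ z′ p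
    agree (_ , i) refl = same i

  isALStream : ∀ z → IsALStream (gadgetGraph K z n) (segment z (half false) ++ segment z (half true))
  isALStream z = half false ++ half true , filter-sides sideOf (allFin n) , nb
    , (λ v → Unique.filter⁺ (joined? K z (roleOf v) ∘ roleOf) (Unique.allFin⁺ n) , λ u → mk⇔
        (λ m → Joined⇒adj {z = z} v u (proj₂ (∈-filter⁻ (joined? K z (roleOf v) ∘ roleOf) {xs = allFin n} m)))
        (λ a → ∈-filter⁺ (joined? K z (roleOf v) ∘ roleOf) (∈-allFin u) (adj⇒Joined {z = z} v u a)))
    , sym (concatMap-++ (λ v → vtx v ∷ map (edg v) (nb v)) (half false) (half true))
    where
    nb : Fin n → List (Fin n)
    nb v = neighbours (z (port (roleOf v))) v

-- Gadgets beyond the input, some of them truncated by the number of vertices, are attached.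
extend : ∀ {T} → Vec Bool T → ℕ → Bool
extend []      _       = true
extend (b ∷ _) zero    = b
extend (_ ∷ x) (suc i) = extend x i

-- The fooling set of complementary inputs

complement : ∀ {T} → Vec Bool T → Vec Bool T
complement = Vec.map not

extend-complement : ∀ {T} (x : Vec Bool T) i →
  extend x i ≡ true ⊎ (extend (complement x) i ≡ true × suc i ≤ T)
extend-complement []          i       = inj₁ refl
extend-complement (true ∷ x)  zero    = inj₁ refl
extend-complement (false ∷ x) zero    = inj₂ (refl , s≤s z≤n)
extend-complement (b ∷ x)     (suc i) with extend-complement x i
... | inj₁ e       = inj₁ e
... | inj₂ (e , l) = inj₂ (e , s≤s l)

complement-involutive : ∀ {T} (x : Vec Bool T) → complement (complement x) ≡ x
complement-involutive []      = refl
complement-involutive (b ∷ x) = cong₂ _∷_ (Bool.not-involutive b) (complement-involutive x)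

Clash : ∀ {T} → Vec Bool T → Vec Bool T → Set
Clash {T} x y = Σ ℕ λ i → suc i ≤ T × extend x i ≡ false × extend y i ≡ false

Clash-∷ : ∀ {T b c} {x y : Vec Bool T} → Clash x y → Clash (b ∷ x) (c ∷ y)
Clash-∷ (i , i<T , e) = suc i , s≤s i<T , e

-- Where `x` and `y` differ, one has the bit `false` and so does the complement of the other. The
-- direction of the difference decides which of the two crossed inputs loses a gadget.
clash : ∀ {T} (x y : Vec Bool T) → x ≢ y → Clash x (complement y) ⊎ Clash y (complement x)
clash []          []          ne = ⊥-elim (ne refl)
clash (false ∷ x) (true ∷ y)  ne = inj₁ (0 , s≤s z≤n , refl , refl)
clash (true ∷ x)  (false ∷ y) ne = inj₂ (0 , s≤s z≤n , refl , refl)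
clash (false ∷ x) (false ∷ y) ne = Sum.map Clash-∷ Clash-∷ (clash x y (ne ∘ cong (false ∷_)))
clash (true ∷ x)  (true ∷ y)  ne = Sum.map Clash-∷ Clash-∷ (clash x y (ne ∘ cong (true ∷_)))

-- Gadget 0 is fixed half attached, as `Anchored` demands, so input bits start at gadget 1.
wiring : ∀ {T} → Vec Bool T → Vec Bool T → Port → Bool
wiring x y (false , zero)  = true
wiring x y (true , zero)   = false
wiring x y (false , suc i) = extend x i
wiring x y (true , suc i)  = extend y i

module _ (K : Core) {n p s T : ℕ} (T≤ : suc T * 4 ≤ n) (A : Alg n p s)
  (correct : ∀ z → Anchored z → ∀ str → IsALStream (gadgetGraph K z n) str →
     (runAlg A str ≡ true ⇔ Connected (gadgetGraph K z n)))
  where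

  private
    Input = Vec Bool T
    State = Vec Bool s

    pass : List (Item n) → Fin p → State → State
    pass str i st = foldl (Alg.next A i) st str

    alice bob : Input → List (Item n)
    -- The other player's argument is a filler: by `segment-local` each half reads only the bits of
    -- its own side.
    alice x = segment K n (wiring x x) (half K n false)
    bob y   = segment K n (wiring y y) (half K n true)

    final : Input → Input → State
    final x y = run (pass ∘ alice) (pass ∘ bob) x y (Alg.init A) (allFin p)

    stream : ∀ x y → IsALStream (gadgetGraph K (wiring x y) n) (alice x ++ bob y)
    stream x y = subst (IsALStream (gadgetGraph K (wiring x y) n)) (cong₂ _++_
      (segment-local K n {wiring x y} {wiring x x} false λ { zero → refl ; (suc i) → refl })
      (segment-local K n {wiring x y} {wiring y y} true λ { zero → refl ; (suc i) → refl })) (isALStream K n (wiring x y))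

    runAlg-final : ∀ x y → runAlg A (alice x ++ bob y) ≡ Alg.out A (final x y)
    runAlg-final x y = cong (Alg.out A) (go (allFin p) (Alg.init A))
      where
      go : ∀ L st → foldl (λ st i → pass (alice x ++ bob y) i st) st L ≡
                    run (pass ∘ alice) (pass ∘ bob) x y st L
      go []       st = refl
      go (i ∷ L) st rewrite foldl-++ (Alg.next A i) st (alice x) (bob y) = go L _

    accepted : ∀ x → Alg.out A (final x (complement x)) ≡ true
    accepted x = trans (sym (runAlg-final x (complement x)))
      (Equivalence.from (correct (wiring x (complement x)) (refl , refl) _ (stream x (complement x))) (connected T≤ attached))
      where
      attached : ∀ q → wiring x (complement x) q ≡ true ⊎
                       (wiring x (complement x) (flip q) ≡ true × proj₂ q ≤ T)
      attached (false , zero)  = inj₁ refl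
      attached (true , zero)   = inj₂ (refl , z≤n)
      attached (false , suc i) = extend-complement x i
      attached (true , suc i)  = subst (λ x′ → extend (complement x) i ≡ true ⊎ (extend x′ i ≡ true × suc i ≤ T))
        (complement-involutive x) (extend-complement (complement x) i)

    rejected : ∀ x y → Clash x y → Alg.out A (final x y) ≢ true
    rejected x y (i , i<T , ex , ey) acc =
      disconnected {z = wiring x y} T≤ (false , suc i) i<T ex ey
        (Equivalence.to (correct (wiring x y) (refl , refl) _ (stream x y)) (trans (runAlg-final x y) acc))

    trace : Input → Vec (State × State) (length (allFin p))
    trace x = transcript (pass ∘ alice) (pass ∘ bob) x (complement x) (Alg.init A) (allFin p)

    -- By `run-mixed`, equal traces make both crossed inputs end like the accepted ones, yet by
    -- `clash` one of them is disconnected.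
    trace-injective : ∀ x x′ → trace x ≡ trace x′ → ¬ (x ≢ x′)
    trace-injective x x′ eq ne with clash x x′ ne
    ... | inj₁ c = rejected x (complement x′) c
      (trans (cong (Alg.out A) (run-mixed (pass ∘ alice) (pass ∘ bob) (Alg.init A) (allFin p) eq))
             (accepted x))
    ... | inj₂ c = rejected x′ (complement x) c
      (trans (cong (Alg.out A) (run-mixed (pass ∘ alice) (pass ∘ bob) (Alg.init A) (allFin p) (sym eq)))
             (accepted x′))

    encodePair : State × State → Fin (2 ^ s * 2 ^ s)
    encodePair (a , b) = combine (encode bit s a) (encode bit s b)

    encodePair-injective : ∀ {a b} → encodePair a ≡ encodePair b → a ≡ b
    encodePair-injective eq with combine-injective _ _ _ _ eq
    ... | e , e′ = cong₂ _,_ (encode-injective bit-injective s e) (encode-injective bit-injective s e′)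

    transcripts : (2 ^ s * 2 ^ s) ^ length (allFin p) ≡ 2 ^ ((s + s) * length (allFin p))
    transcripts = trans (cong (_^ length (allFin p)) (sym (^-distribˡ-+-* 2 s s))) (^-*-assoc 2 (s + s) _)

  -- Otherwise the `2 ^ T` inputs would outnumber the transcripts, which consist of two memory
  -- states per pass, and two inputs would share a transcript.
  input≤transcript : T ≤ (s + s) * length (allFin p)
  input≤transcript = ≮⇒≥ λ lt →
    let i , j , i<j , eq = pigeonhole (subst (_< 2 ^ T) (sym transcripts) (^-monoʳ-< 2 (s≤s (s≤s z≤n)) lt))
                                 (encode encodePair (length (allFin p)) ∘ trace ∘ bits T)
    in trace-injective _ _ (encode-injective encodePair-injective _ eq) λ same →
         Fin.<⇒≢ i<j (trans (sym (encode-bits T i)) (trans (cong (encode bit T) same) (encode-bits T j)))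

-- Number of gadgets and the linear bound

record Size (n : ℕ) : Set where
  field
    T     : ℕ
    1≤T   : 1 ≤ T
    -- Gadget 0 and the `T` input gadgets fit completely, and at most three vertices are left over.
    lower : suc T * 4 ≤ n
    upper : n ≤ 7 + T * 4

size : ∀ k → Size (8 + k)
size 0 = record { T = 1 ; 1≤T = ≤-refl ; lower = ≤-refl ; upper = m≤n+m 8 3 }
size 1 = record { T = 1 ; 1≤T = ≤-refl ; lower = m≤n+m 8 1 ; upper = m≤n+m 9 2 }
size 2 = record { T = 1 ; 1≤T = ≤-refl ; lower = m≤n+m 8 2 ; upper = m≤n+m 10 1 }
size 3 = record { T = 1 ; 1≤T = ≤-refl ; lower = m≤n+m 8 3 ; upper = ≤-refl }
size (suc (suc (suc (suc k)))) = record
  { T = suc T ; 1≤T = s≤s z≤n ; lower = +-monoʳ-≤ 4 lower ; upper = +-monoʳ-≤ 4 upper }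
  where open Size (size k)

-- The constant is `15 = 7 + 2 * 4`. Absorbing the additive 7 into `7 * q` requires `q` to be
-- positive, which `1 ≤ T` ensures.
linearBound : ∀ {n T q} → 1 ≤ T → n ≤ 7 + T * 4 → T ≤ 2 * q → n ≤ 15 * q
linearBound {q = zero}  1≤T _ T≤2q with ≤-trans 1≤T T≤2q
... | ()
linearBound {n} {T} {suc q} 1≤T n≤ T≤2q = begin
  n                     ≤⟨ n≤ ⟩
  7 + T * 4             ≤⟨ +-mono-≤ (m≤m*n 7 (suc q)) (*-monoˡ-≤ 4 T≤2q) ⟩
  7 * suc q + 2 * suc q * 4  ≡⟨ solve 1 (λ q → con 7 :* q :+ con 2 :* q :* con 4 := con 15 :* q) refl (suc q) ⟩
  15 * suc q            ∎
  where
  open ≤-Reasoning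
  open +-*-Solver

theorem5 : ∀ {m} (H : Graph m) → ¬ SmallLinearForest 5 H →
    Σ ℕ λ k → Σ ℕ λ N → ∀ n p s → N ≤ n → 1 ≤ p →
    (A : Alg n p s) → SolvesConnHFree H A → n ≤ k * (p * s)
-- The threshold 8 leaves room for gadget 0 and one input gadget.
theorem5 H notSmall = 15 , 8 , bounded
  where
  -- Which of the two families avoids H need not be known: the bound is decidable, hence stable.
  bounded : ∀ n p s → 8 ≤ n → 1 ≤ p → (A : Alg n p s) → SolvesConnHFree H A → n ≤ 15 * (p * s)
  bounded n p s 8≤n _ A solves = linearBound {q = p * s} 1≤T upper (subst (T ≤_) memory
    -- If the bound failed, a copy of `H` in a clique graph would make the whole star family
    -- `H`-free and so yield the bound; hence the clique family is `H`-free and yields it instead.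
    (decidable-stable (T ≤? _) λ small → small (fromFamily clique λ z _ inClique →
      small (fromFamily star λ z′ anchored inStar → notSmall (smallFromBoth H {z = z} {z′ = z′} anchored inClique inStar)))))
    where
    open Size (subst Size (m+[n∸m]≡n 8≤n) (size (n ∸ 8)))
    fromFamily : ∀ K → (∀ z → Anchored z → Free H (gadgetGraph K z n)) → T ≤ (s + s) * length (allFin p)
    fromFamily K free = input≤transcript K lower A λ z anchored → solves (gadgetGraph K z n) (free z anchored)
    memory : (s + s) * length (allFin p) ≡ 2 * (p * s)
    memory = trans (cong ((s + s) *_) (length-tabulate {n = p} (λ i → i)))
      (solve 2 (λ p s → (s :+ s) :* p := con 2 :* (p :* s)) refl p s)
      where open +-*-Solver
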